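{- Let $G$ be a finite simple graph and let \[ Y_G=\sum_{\alpha}X_G^\alpha, \] where the sum ranges over all maps $\alpha:V(G)\to\mathbb{N}$. Then the following conditions are equivalent: (1) $[s_\lambda]Y_G\ge 0$ for all partitions $\lambda$ with $\ell(\lambda)\le 2$. (2) $[s_{(k,k)}]Y_G\ge 0$ for all $k\ge 1$. (3) The independence polynomial $I_G(t)$ is log-concave. (4) The independence polynomial $I_G(t)$ is strongly log-concave.
   Context: $\mathbb{N}=\{0,1,2,\ldots\}$ and $\mathbf{x}=\{x_1,x_2,\ldots\}$ is a set of indeterminates. For $\alpha:V(G)\to\mathbb{N}$, a multicoloring of $G$ of type $\alpha$ is a map $\kappa$ assigning to each vertex $v$ a finite set $\kappa(v)$ of positive integers with $|\kappa(v)|=\alpha(v)$; it is proper if $\kappa(u)\cap\kappa(v)=\emptyset$ for every edge $uv$. Define $X_G^\alpha=\sum_\kappa x_1^{a_1}x_2^{a_2}\cdots$, summed over all proper multicolorings $\kappa$ of type $\alpha$, where $a_i$ is the number of vertices $v$ with $i\in\kappa(v)$. The series $Y_G$ is a symmetric formal power series whose homogeneous components are symmetric functions; $[s_\lambda]Y_G$ denotes the coefficient of the Schur function $s_\lambda$ in the Schur expansion of the component of degree $|\lambda|$. The length $\ell(\lambda)$ is the number of parts of $\lambda$. The independence polynomial is $I_G(t)=\sum_{j=0}^{\alpha(G)} i_jt^j$, where $i_j$ is the number of independent sets of $G$ of cardinality $j$ ($i_0=1$) and $\alpha(G)$ is the maximum size of an independent set. A polynomial $a_0+\cdots+a_dt^d$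 is log-concave if $a_j^2\ge a_{j-1}a_{j+1}$ for all $1\le j\le d-1$, and strongly log-concave if $a_ma_n\ge a_pa_q$ for all integers $0\le p<m\le n<q\le d$ with $m+n=p+q$. -}

module Defs where

open import Data.Bool using (Bool; true; false)
open import Data.Fin as Fin using (Fin)
import Data.Fin.Properties as Fin
open import Data.Fin.Subset using (Subset; _∈_; _∩_; ∣_∣; Empty)
open import Data.Fin.Subset.Properties using (_∈?_; nonempty?)
open import Data.Integer as ℤ using (ℤ; +_; 0ℤ)
open import Data.List
  using (List; []; _∷_; map; filter; foldr; length; concat; concatMap; zip;
         cartesianProductWith; mapMaybe; upTo; allFin)
open import Data.List.Extrema.Nat using (max)
open import Data.List.Relation.Unary.All as All using (All; []; _∷_)
open import Data.List.Relation.Unary.Linked as Linked using (Linked; [-]; _∷_)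
open import Data.Maybe as Maybe using (Maybe)
open import Data.Nat
  using (ℕ; zero; suc; _+_; _*_; _∸_; _≤_; _<_; _≥_; _≟_; _≥?_; _<?_)
open import Data.Nat.ListAction using (sum)
open import Data.Nat.Properties using (≤-refl)
open import Data.Product using (_×_; _,_; uncurry)
open import Data.Vec as Vec using (Vec; []; _∷_; lookup)
open import Relation.Binary.Core using (Rel)
open import Relation.Binary.Definitions using (Decidable; Symmetric; Irreflexive)
open import Relation.Binary.PropositionalEquality using (_≡_)
open import Relation.Nullary using (¬_; Dec; ¬?; _×-dec_; _→-dec_)
open import Relation.Nullary.Decidable using (dec⇒maybe)
import Relation.Unary as Unary
open import Level using (Level; 0ℓ)

private variable
  ℓ p : Level
  A   : Set ℓ

------------------------------------------------------------------------
-- Finite enumeration and counting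

count : {P : A → Set p} → Unary.Decidable P → List A → ℕ
count P? xs = length (filter P? xs)

vecs : List A → ∀ n → List (Vec A n)
vecs xs zero    = [] ∷ []
vecs xs (suc n) = cartesianProductWith _∷_ xs (vecs xs n)

subsets : ∀ n → List (Subset n)
subsets = vecs (true ∷ false ∷ [])

sumℤ : List ℤ → ℤ
sumℤ = foldr ℤ._+_ 0ℤ

------------------------------------------------------------------------
-- Finite simple graphs

record Graph : Set₁ where
  field
    order  : ℕ
    _~_    : Rel (Fin order) 0ℓ
    _~?_   : Decidable _~_
    sym    : Symmetric _~_
    irrefl : Irreflexive _≡_ _~_

------------------------------------------------------------------------
-- Formal power series in x₁, x₂, … over ℤ

-- A series is given by its coefficients: a : Vec ℕ k stands for the
-- monomial x₁^a₁ ⋯ x_k^a_k.  Every monomial has this form for some k.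
Series : Set
Series = ∀ {k} → Vec ℕ k → ℤ

------------------------------------------------------------------------
-- Multicolourings and the series Y_G

module _ (G : Graph) where
  open Graph G

  -- κ(v) = lookup κ v.  A multicolouring contributing to the monomial
  -- x₁^a₁ ⋯ x_k^a_k uses no colour beyond k, so its colour sets are
  -- subsets of a k-element set; Fin.zero plays the role of colour 1.
  Multicolouring : ℕ → Set
  Multicolouring k = Vec (Subset k) order

  HasType : ∀ {k} → (Fin order → ℕ) → Multicolouring k → Set
  HasType α κ = ∀ v → ∣ lookup κ v ∣ ≡ α v

  Proper : ∀ {k} → Multicolouring k → Set
  Proper κ = ∀ u v → u ~ v → Empty (lookup κ u ∩ lookup κ v)

  HasMonomial : ∀ {k} → Vec ℕ k → Multicolouring k → Set
  HasMonomial a κ = ∀ i → Vec.count (i ∈?_) κ ≡ lookup a i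

  hasType? : ∀ {k} α → Unary.Decidable (HasType {k} α)
  hasType? α κ = Fin.all? λ v → ∣ lookup κ v ∣ ≟ α v

  proper? : ∀ {k} → Unary.Decidable (Proper {k})
  proper? κ = Fin.all? λ u → Fin.all? λ v →
    (u ~? v) →-dec ¬? (nonempty? (lookup κ u ∩ lookup κ v))

  hasMonomial? : ∀ {k} (a : Vec ℕ k) → Unary.Decidable (HasMonomial a)
  hasMonomial? a κ = Fin.all? λ i → Vec.count (i ∈?_) κ ≟ lookup a i

  X : (Fin order → ℕ) → Series
  X α {k} a =
    + count (λ κ → proper? κ ×-dec hasType? α κ ×-dec hasMonomial? a κ)
            (vecs (subsets k) order)

  -- The sum of X α over all α : V(G) → ℕ.  For a monomial in x₁, …, x_k
  -- only the α with values in {0, …, k} are listed: a set of colours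
  -- among 1, …, k has at most k elements, so any other α contributes 0.
  Y : Series
  Y {k} a = sumℤ (map (λ α → X (lookup α) a) (vecs (upTo (suc k)) order))

------------------------------------------------------------------------
-- Partitions and Schur functions

record Partition : Set where
  constructor partition
  field
    parts      : List ℕ
    decreasing : Linked _≥_ parts
    positive   : All (0 <_) parts

open Partition public

ℓ⟨_⟩ : Partition → ℕ
ℓ⟨ μ ⟩ = length (parts μ)

toPartition : List ℕ → Maybe Partition
toPartition xs = Maybe.map (λ (d , p) → partition xs d p)
  (dec⇒maybe (Linked.linked? _≥?_ xs ×-dec All.all? (0 <?_) xs))

-- All partitions of d, found among the lists of length ≤ d with entries ≤ d.
partitions : ℕ → List Partition
partitions d = mapMaybe toPartition (filter (λ xs → sum xs ≟ d)
  (concatMap (λ l → map Vec.toList (vecs (upTo (suc d)) l)) (upTo (suc d))))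

twoEqualParts : ∀ k → 1 ≤ k → Partition
twoEqualParts k k≥1 = partition (k ∷ k ∷ []) (≤-refl ∷ [-]) (k≥1 ∷ k≥1 ∷ [])

-- A tableau is the list of its rows, top row first (English notation).
Tableau : ℕ → Set
Tableau k = List (List (Fin k))

fillings : ∀ k → List ℕ → List (Tableau k)
fillings k []       = [] ∷ []
fillings k (l ∷ ls) =
  cartesianProductWith _∷_ (map Vec.toList (vecs (allFin k) l)) (fillings k ls)

-- zip truncates to the shorter row, i.e. it pairs vertically adjacent cells.
_Above_ : ∀ {k} → Rel (List (Fin k)) 0ℓ
r Above r′ = All (uncurry Fin._<_) (zip r r′)

Semistandard : ∀ {k} → Tableau k → Set
Semistandard T = All (Linked Fin._≤_) T × Linked _Above_ T

HasContent : ∀ {k} → Vec ℕ k → Tableau k → Set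
HasContent a T = ∀ i → count (i Fin.≟_) (concat T) ≡ lookup a i

semistandard? : ∀ {k} → Unary.Decidable (Semistandard {k})
semistandard? T =
  All.all? (Linked.linked? Fin._≤?_) T ×-dec
  Linked.linked? (λ r r′ → All.all? (λ (i , j) → i Fin.<? j) (zip r r′)) T

hasContent? : ∀ {k} (a : Vec ℕ k) → Unary.Decidable (HasContent a)
hasContent? a T = Fin.all? λ i → count (i Fin.≟_) (concat T) ≟ lookup a i

-- s_μ is the generating function of semistandard tableaux of shape μ.
s : Partition → Series
s μ {k} a =
  + count (λ T → semistandard? T ×-dec hasContent? a T) (fillings k (parts μ))

-- A Schur expansion of f: for each d, the degree-d component of f equals
-- Σ_{μ ⊢ d} [s μ ] s_μ.  The Schur functions being a ℤ-basis of the symmetric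
-- functions, every symmetric series over ℤ has exactly one such expansion.
record SchurExpansion (f : Series) : Set where
  field
    [s_]    : Partition → ℤ
    expands : ∀ {k} (a : Vec ℕ k) →
              f a ≡ sumℤ (map (λ μ → [s μ ] ℤ.* s μ a) (partitions (Vec.sum a)))

------------------------------------------------------------------------
-- The independence polynomial

module _ (G : Graph) where
  open Graph G

  Independent : Subset order → Set
  Independent S = ∀ u v → u ∈ S → v ∈ S → ¬ (u ~ v)

  independent? : Unary.Decidable Independent
  independent? S = Fin.all? λ u → Fin.all? λ v →
    (u ∈? S) →-dec (v ∈? S) →-dec ¬? (u ~? v)

  independenceNumber : ℕ
  independenceNumber = max 0 (map ∣_∣ (filter independent? (subsets order)))

  independentSets : ℕ → ℕ
  independentSets j =
    count (λ S → independent? S ×-dec (∣ S ∣ ≟ j)) (subsets order)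

-- A polynomial a₀ + a₁ t + ⋯ + a_d t^d with coefficients in ℕ; coefficients
-- beyond degree are not part of the polynomial.
record Polynomial : Set where
  constructor poly
  field
    degree : ℕ
    coeff  : ℕ → ℕ

independencePolynomial : Graph → Polynomial
independencePolynomial G = poly (independenceNumber G) (independentSets G)

LogConcave : Polynomial → Set
LogConcave (poly d a) =
  ∀ j → 1 ≤ j → j < d → a (j ∸ 1) * a (j + 1) ≤ a j * a j

StronglyLogConcave : Polynomial → Set
StronglyLogConcave (poly d a) =
  ∀ p m n q → p < m → m ≤ n → n < q → q ≤ d → m + n ≡ p + q →
  a p * a q ≤ a m * a n

{-# OPTIONS --safe #-}

module Submission where

open import Defs
open import Data.Bool using (true; false)
open import Data.Fin as Fin using (Fin; zero; suc)
import Data.Fin.Properties as Fin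
open import Data.Fin.Subset as Subset using (Subset; inside; outside; ∣_∣; _⊆_)
open import Data.Fin.Subset.Properties
  using (_∈?_; ∣p∣≤n; x∈p∩q⁺; x∈p∩q⁻; ∣⊥∣≡0; ∉⊥; out⊆; s⊆s)
open import Data.Integer as ℤ using (ℤ; +_; 0ℤ; 1ℤ) renaming (_≤_ to _≤ℤ_)
import Data.Integer.Properties as ℤ
import Data.Integer.Tactic.RingSolver as ℤ-Solver
open import Data.List
  using (List; []; _∷_; [_]; _++_; map; filter; length; concat; concatMap; replicate;
         cartesianProduct; cartesianProductWith; mapMaybe; upTo; allFin)
open import Data.List.Extrema.Nat using (xs≤max; argmax-sel)
open import Data.List.Membership.Propositional using (_∈_)
open import Data.List.Membership.Propositional.Properties
  using (∈-filter⁺; ∈-filter⁻; ∈-map⁺; ∈-map⁻; ∈-upTo⁺; ∈-allFin; ∈-concat⁺′;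
         ∈-cartesianProductWith⁺; ∈-cartesianProductWith⁻; ∈-cartesianProduct⁺)
open import Data.List.Membership.Propositional.Properties.WithK using (unique∧set⇒bag)
open import Data.List.Properties as List
  using (length-map; length-++; length-replicate; filter-++; filter-≐; filter-none;
         filter-some; filter-accept; filter-reject; ++-identityʳ)
open import Data.List.Relation.Binary.BagAndSetEquality using (∼bag⇒↭)
open import Data.List.Relation.Binary.Permutation.Propositional.Properties using (↭-length)
open import Data.List.Relation.Unary.All as All using (All; []; _∷_)
import Data.List.Relation.Unary.All.Properties as All
open import Data.List.Relation.Unary.AllPairs as AllPairs using ([]; _∷_)
import Data.List.Relation.Unary.AllPairs.Properties as AllPairs
open import Data.List.Relation.Unary.Any as Any using (here; there)
open import Data.List.Relation.Unary.Linked as Linked using (Linked; []; [-]; _∷_)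
open import Data.List.Relation.Unary.Unique.Propositional using (Unique)
import Data.List.Relation.Unary.Unique.Propositional.Properties as Unique
open import Data.Nat
  using (ℕ; zero; suc; _+_; _*_; _∸_; _≤_; _<_; _≥_; z≤n; s≤s; _≟_; _≥?_; _<?_;
         NonZero; >-nonZero)
open import Data.Nat.ListAction using (sum)
import Data.Nat.Properties as ℕ
import Data.Nat.Tactic.RingSolver as ℕ-Solver
open import Data.Product using (_×_; _,_; ∃; ∃₂; proj₁; proj₂)
open import Data.Sum using (inj₁; inj₂)
open import Data.Unit using (tt)
open import Data.Vec as Vec using (Vec; []; _∷_; lookup)
import Data.Vec.Properties as Vec
import Data.Vec.Relation.Unary.All.Properties as VecAll
open import Function using (_∘_; id)
open import Function.Bundles using (_⇔_; mk⇔; Equivalence)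
open import Level using (Level)
open import Relation.Binary.Definitions using (tri<; tri≈; tri>)
open import Relation.Binary.PropositionalEquality
  using (_≡_; _≢_; refl; sym; trans; cong; cong₂; subst; module ≡-Reasoning)
open import Relation.Nullary using (¬_; yes; no; does; contradiction; _×-dec_)
open import Relation.Nullary.Decidable using (does-⇔)
open import Relation.Unary using (Pred; Decidable)

-- A colour of a multicolouring selects an independent set, so the coefficient
-- of x₁^a₁ ⋯ x_k^a_k in Y_G is i_{a₁} ⋯ i_{a_k}.  In two variables s_μ vanishes
-- if ℓ(μ) > 2, and the coefficient of x₁^m x₂^n (n ≤ m) in s_(p,q) with
-- p + q = m + n is 1 if q ≤ n and 0 otherwise.  Comparing the coefficients of
-- x₁^m x₂^n and x₁^(m+1) x₂^(n-1) therefore isolates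
--   [s_(m,n)] Y_G = i_m i_n - i_{m+1} i_{n-1}.
-- For m = n these are the log-concavity inequalities.  Subsets of independent
-- sets are independent, so I_G has no internal zeros and log-concavity implies
-- the inequalities for all m ≥ n, and by iteration strong log-concavity.

private variable
  ℓ p q r : Level
  A B C : Set ℓ
  m n k : ℕ

-- Counting

module _ {A B : Set ℓ} {P : Pred A p} {Q : Pred B q} {P? : Decidable P} {Q? : Decidable Q} where

  -- Duplicate-free lists with the same members are permutations of each other; injectivity of `f`
  -- keeps the image of the first filtered list duplicate-free.
  count-bijection : ∀ {xs ys} → Unique xs → Unique ys →
    (f : A → B) → (∀ {x y} → f x ≡ f y → x ≡ y) →
    (∀ {x} → x ∈ xs → P x → f x ∈ ys × Q (f x)) →
    (∀ {y} → y ∈ ys → Q y → ∃ λ x → x ∈ xs × P x × y ≡ f x) →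
    count P? xs ≡ count Q? ys
  count-bijection {xs} {ys} xs! ys! f inj to from = begin
    length (filter P? xs)          ≡⟨ length-map f (filter P? xs) ⟨
    length (map f (filter P? xs))  ≡⟨ ↭-length (∼bag⇒↭ (unique∧set⇒bag
                                        (Unique.map⁺ inj (Unique.filter⁺ P? xs!))
                                        (Unique.filter⁺ Q? ys!) (mk⇔ ⇒ ⇐))) ⟩
    length (filter Q? ys)          ∎
    where
    open ≡-Reasoning
    ⇒ : ∀ {y} → y ∈ map f (filter P? xs) → y ∈ filter Q? ys
    ⇒ y∈ with x , x∈ , refl ← ∈-map⁻ f y∈ =
      let x∈xs , Px = ∈-filter⁻ P? x∈ ; fx∈ , Qfx = to x∈xs Px in ∈-filter⁺ Q? fx∈ Qfx
    ⇐ : ∀ {y} → y ∈ filter Q? ys → y ∈ map f (filter P? xs)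
    ⇐ y∈ with y∈ys , Qy ← ∈-filter⁻ Q? y∈ with x , x∈ , Px , refl ← from y∈ys Qy =
      ∈-map⁺ f (∈-filter⁺ P? x∈ Px)

module _ {A : Set} {P : Pred A p} {P? : Decidable P} where

  count-none : ∀ {xs} → (∀ {x} → x ∈ xs → ¬ P x) → count P? xs ≡ 0
  count-none none = cong length (filter-none P? (All.tabulate none))

  count-unique : ∀ {xs x} → Unique xs → x ∈ xs → P x →
                 (∀ {y} → y ∈ xs → P y → y ≡ x) → count P? xs ≡ 1
  count-unique {x = x} xs! x∈xs Px only = sym (count-bijection {P? = λ _ → yes tt}
    ([] ∷ []) xs! (λ _ → x) (λ _ → refl)
    (λ _ _ → x∈xs , Px) (λ y∈ Py → tt , here refl , tt , only y∈ Py))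

count-map : {P : Pred B p} (P? : Decidable P) (f : A → B) (xs : List A) →
            count P? (map f xs) ≡ count (P? ∘ f) xs
count-map P? f []       = refl
count-map P? f (x ∷ xs) with does (P? (f x))
... | true  = cong suc (count-map P? f xs)
... | false = count-map P? f xs

count-++ : {P : Pred A p} (P? : Decidable P) (xs ys : List A) →
           count P? (xs ++ ys) ≡ count P? xs + count P? ys
count-++ P? xs ys = trans (cong length (filter-++ P? xs ys)) (length-++ (filter P? xs))

count-cong : {P : Pred A p} {Q : Pred A q} (P? : Decidable P) (Q? : Decidable Q) →
             (∀ x → P x ⇔ Q x) → ∀ xs → count P? xs ≡ count Q? xs
count-cong P? Q? P⇔Q xs = cong length
  (filter-≐ P? Q? ((λ {x} → Equivalence.to (P⇔Q x)) , λ {x} → Equivalence.from (P⇔Q x)) xs)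

-- Entries are counted with multiplicity: the block of `x` contributes `count Q? ys` if `P x` holds
-- and nothing otherwise.
count-cartesianProductWith :
  {P : Pred A p} {Q : Pred B q} {R : Pred C r}
  (P? : Decidable P) (Q? : Decidable Q) (R? : Decidable R) (f : A → B → C) →
  (∀ x y → R (f x y) ⇔ (P x × Q y)) →
  ∀ xs ys → count R? (cartesianProductWith f xs ys) ≡ count P? xs * count Q? ys
count-cartesianProductWith P? Q? R? f R⇔ []       ys = refl
count-cartesianProductWith P? Q? R? f R⇔ (x ∷ xs) ys
  rewrite count-++ R? (map (f x) ys) (cartesianProductWith f xs ys)
        | count-map R? (f x) ys
        | count-cartesianProductWith P? Q? R? f R⇔ xs ys
  with P? x
... | yes Px = cong (_+ count P? xs * count Q? ys) (count-cong (R? ∘ f x) Q?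
                 (λ y → mk⇔ (proj₂ ∘ Equivalence.to (R⇔ x y)) (Equivalence.from (R⇔ x y) ∘ (Px ,_))) ys)
... | no ¬Px = cong (_+ count P? xs * count Q? ys)
                 (cong length (filter-none (R? ∘ f x)
                   (All.universal (λ y → ¬Px ∘ proj₁ ∘ Equivalence.to (R⇔ x y)) ys)))

-- Enumerations of vectors and subsets

vecs-! : {xs : List A} → Unique xs → ∀ n → Unique (vecs xs n)
vecs-! xs! zero    = [] ∷ []
vecs-! xs! (suc n) = Unique.cartesianProductWith⁺ _∷_ Vec.∷-injective xs! (vecs-! xs! n)

∈-vecs : {xs : List A} (v : Vec A n) → (∀ i → lookup v i ∈ xs) → v ∈ vecs xs n
∈-vecs []      _ = here refl
∈-vecs (x ∷ v) ∈xs = ∈-cartesianProductWith⁺ _∷_ (∈xs zero) (∈-vecs v (∈xs ∘ suc))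

subsets-! : ∀ n → Unique (subsets n)
subsets-! = vecs-! (((λ ()) ∷ []) ∷ [] ∷ [])

∈-subsets : (S : Subset n) → S ∈ subsets n
∈-subsets S = ∈-vecs S λ i → ∈-bools (lookup S i)
  where
  ∈-bools : ∀ b → b ∈ true ∷ false ∷ []
  ∈-bools true  = here refl
  ∈-bools false = there (here refl)

-- The coordinates are chosen independently. This is the source of the product formula for the
-- coefficients of Y_G.
count-vecs : {P : Fin k → Pred A p} (P? : ∀ i → Decidable (P i)) (xs : List A) →
  count (λ v → Fin.all? λ i → P? i (lookup v i)) (vecs xs k) ≡
  Vec.foldr′ _*_ 1 (Vec.tabulate λ i → count (P? i) xs)
count-vecs {k = zero}  P? xs = refl
count-vecs {k = suc k} P? xs = trans
  (count-cartesianProductWith (P? zero) (λ v → Fin.all? λ i → P? (suc i) (lookup v i)) _ _∷_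
    (λ x v → mk⇔ (λ h → h zero , h ∘ suc) λ { (h₀ , h) zero → h₀ ; (h₀ , h) (suc i) → h i })
    xs (vecs xs k))
  (cong (count (P? zero) xs *_) (count-vecs (P? ∘ suc) xs))

-- Turns the sum over types that defines `Y` into a single count of pairs of a type and a
-- multicolouring.
sumℤ-count : {R : A → Pred B p} (R? : ∀ x → Decidable (R x)) (xs : List A) (ys : List B) →
  sumℤ (map (λ x → + count (R? x) ys) xs) ≡
  + count (λ (x , y) → R? x y) (cartesianProduct xs ys)
sumℤ-count R? []       ys = refl
sumℤ-count R? (x ∷ xs) ys = begin
  + count (R? x) ys ℤ.+ sumℤ (map (λ x → + count (R? x) ys) xs)
    ≡⟨ cong (λ z → + count (R? x) ys ℤ.+ z) (sumℤ-count R? xs ys) ⟩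
  + (count (R? x) ys + count R?′ (cartesianProduct xs ys))
    ≡⟨ cong (λ z → + (z + count R?′ (cartesianProduct xs ys))) (count-map R?′ (x ,_) ys) ⟨
  + (count R?′ (map (x ,_) ys) + count R?′ (cartesianProduct xs ys))
    ≡⟨ cong +_ (count-++ R?′ (map (x ,_) ys) (cartesianProduct xs ys)) ⟨
  + count R?′ (cartesianProduct (x ∷ xs) ys) ∎
  where
  open ≡-Reasoning
  R?′ = λ (x , y) → R? x y

vecCount-cong : {P : Pred A p} {Q : Pred B q} (P? : Decidable P) (Q? : Decidable Q)
  (xs : Vec A n) (ys : Vec B n) → (∀ i → P (lookup xs i) ⇔ Q (lookup ys i)) →
  Vec.count P? xs ≡ Vec.count Q? ys
vecCount-cong P? Q? []       []       P⇔Q = refl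
vecCount-cong P? Q? (x ∷ xs) (y ∷ ys) P⇔Q
  rewrite does-⇔ (P⇔Q zero) (P? x) (Q? y) | vecCount-cong P? Q? xs ys (P⇔Q ∘ suc) = refl

-- The coefficients of Y

lookup-transpose : (xss : Vec (Vec A m) n) (i : Fin m) (j : Fin n) →
                   lookup (lookup (Vec.transpose xss) i) j ≡ lookup (lookup xss j) i
lookup-transpose (xs ∷ xss) i j = trans
  (cong (λ row → lookup row j) (lookup-⊛-∷ xs (Vec.transpose xss) i))
  (lookup-∷ j)
  where
  lookup-⊛-∷ : ∀ {m n} (xs : Vec A m) (yss : Vec (Vec A n) m) i →
    lookup (Vec.replicate m Vec._∷_ Vec.⊛ xs Vec.⊛ yss) i ≡ lookup xs i Vec.∷ lookup yss i
  lookup-⊛-∷ (x ∷ xs) (ys ∷ yss) zero    = refl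
  lookup-⊛-∷ (x ∷ xs) (ys ∷ yss) (suc i) = lookup-⊛-∷ xs yss i
  lookup-∷ : ∀ j → lookup (lookup xs i Vec.∷ lookup (Vec.transpose xss) i) j ≡ lookup (lookup (xs ∷ xss) j) i
  lookup-∷ zero    = refl
  lookup-∷ (suc j) = lookup-transpose xss i j

lookup-ext : (xs ys : Vec A n) → (∀ i → lookup xs i ≡ lookup ys i) → xs ≡ ys
lookup-ext xs ys eq = begin
  xs                        ≡⟨ Vec.tabulate∘lookup xs ⟨
  Vec.tabulate (lookup xs)  ≡⟨ Vec.tabulate-cong eq ⟩
  Vec.tabulate (lookup ys)  ≡⟨ Vec.tabulate∘lookup ys ⟩
  ys                        ∎
  where open ≡-Reasoning

transpose-involutive : (xss : Vec (Vec A m) n) → Vec.transpose (Vec.transpose xss) ≡ xss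
transpose-involutive xss = lookup-ext _ _ λ j → lookup-ext _ _ λ i →
  trans (lookup-transpose (Vec.transpose xss) j i) (lookup-transpose xss i j)

-- A vector `S` of colour classes and the multicolouring `Vec.transpose S` are one incidence matrix,
-- read by colours and by vertices.
∈-transpose : (S : Vec (Subset n) k) (v : Fin n) (c : Fin k) →
              c Subset.∈ lookup (Vec.transpose S) v → v Subset.∈ lookup S c
∈-transpose S v c c∈ = Vec.lookup⇒[]= v (lookup S c)
  (trans (sym (lookup-transpose S v c)) (Vec.[]=⇒lookup c∈))

∈-transpose⁻ : (S : Vec (Subset n) k) (v : Fin n) (c : Fin k) →
               v Subset.∈ lookup S c → c Subset.∈ lookup (Vec.transpose S) v
∈-transpose⁻ S v c v∈ = Vec.lookup⇒[]= c (lookup (Vec.transpose S) v)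
  (trans (lookup-transpose S v c) (Vec.[]=⇒lookup v∈))

module _ (G : Graph) where
  open Graph G using (order; _~_)

  -- `∣_∣` is itself a `Vec.count`, so the two counts can be compared vertex by vertex.
  colourClass-size : (S : Vec (Subset order) k) (c : Fin k) →
                     Vec.count (c ∈?_) (Vec.transpose S) ≡ ∣ lookup S c ∣
  colourClass-size S c = vecCount-cong _ _ (Vec.transpose S) (lookup S c) λ v →
    mk⇔ (Vec.[]=⇒lookup ∘ ∈-transpose S v c)
        (∈-transpose⁻ S v c ∘ Vec.lookup⇒[]= v (lookup S c))

  IndependentOfSizes : Vec ℕ k → Vec (Subset order) k → Set
  IndependentOfSizes a S = ∀ c → Independent G (lookup S c) × ∣ lookup S c ∣ ≡ lookup a c

  independentOfSizes? : (a : Vec ℕ k) → Decidable (IndependentOfSizes a)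
  independentOfSizes? a S = Fin.all? λ c → independent? G (lookup S c) ×-dec (∣ lookup S c ∣ ≟ lookup a c)

  -- A colour shared by the two ends of an edge is the same thing as an edge inside the class of
  -- that colour.
  proper⇔independent : (S : Vec (Subset order) k) →
    Proper G (Vec.transpose S) ⇔ (∀ c → Independent G (lookup S c))
  proper⇔independent S = mk⇔
    (λ proper c u v u∈ v∈ u~v →
      proper u v u~v (c , x∈p∩q⁺ (∈-transpose⁻ S u c u∈ , ∈-transpose⁻ S v c v∈)))
    (λ indep u v u~v (c , c∈) →
      let c∈u , c∈v = x∈p∩q⁻ (lookup (Vec.transpose S) u) (lookup (Vec.transpose S) v) c∈
      in indep c u v (∈-transpose S u c c∈u) (∈-transpose S v c c∈v) u~v)

  -- The exponents prescribe the sizes of the colour classes. With the type summed out, the classes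
  -- are arbitrary independent sets of these sizes, chosen independently.
  Y-coefficient : (a : Vec ℕ k) → Y G a ≡ + Vec.foldr′ _*_ 1 (Vec.map (independentSets G) a)
  Y-coefficient {k} a = begin
    Y G a
      ≡⟨ sumℤ-count (λ α κ → proper? G κ ×-dec hasType? G (lookup α) κ ×-dec hasMonomial? G a κ) αs κs ⟩
    + count typed? (cartesianProduct αs κs)
      ≡⟨ cong +_ (count-bijection {P? = independentOfSizes? a} {Q? = typed?}
           (vecs-! (subsets-! order) k)
           (Unique.cartesianProduct⁺ (vecs-! (Unique.upTo⁺ (suc k)) order) (vecs-! (subsets-! k) order))
           f f-injective (λ {S} _ → to S) (λ _ → from)) ⟨
    + count (independentOfSizes? a) (vecs (subsets order) k)
      ≡⟨ cong +_ (count-vecs (λ c T → independent? G T ×-dec (∣ T ∣ ≟ lookup a c)) (subsets order)) ⟩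
    + Vec.foldr′ _*_ 1 (Vec.tabulate λ c → independentSets G (lookup a c))
      ≡⟨ cong (λ v → + Vec.foldr′ _*_ 1 v)
           (trans (Vec.tabulate-∘ (independentSets G) (lookup a))
                  (cong (Vec.map (independentSets G)) (Vec.tabulate∘lookup a))) ⟩
    + Vec.foldr′ _*_ 1 (Vec.map (independentSets G) a) ∎
    where
    open ≡-Reasoning
    αs = vecs (upTo (suc k)) order
    κs = vecs (subsets k) order

    Typed : Vec ℕ order × Multicolouring G k → Set
    Typed (α , κ) = Proper G κ × HasType G (lookup α) κ × HasMonomial G a κ
    typed? : Decidable Typed
    typed? (α , κ) = proper? G κ ×-dec hasType? G (lookup α) κ ×-dec hasMonomial? G a κ

    -- The colour classes of a multicolouring are the rows of its transpose,
    -- and its type is determined by it.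
    f : Vec (Subset order) k → Vec ℕ order × Multicolouring G k
    f S = Vec.map ∣_∣ (Vec.transpose S) , Vec.transpose S

    f-injective : ∀ {S T} → f S ≡ f T → S ≡ T
    f-injective {S} {T} eq = begin
      S                                  ≡⟨ transpose-involutive S ⟨
      Vec.transpose (Vec.transpose S)    ≡⟨ cong (Vec.transpose ∘ proj₂) eq ⟩
      Vec.transpose (Vec.transpose T)    ≡⟨ transpose-involutive T ⟩
      T                                  ∎

    to : ∀ S → IndependentOfSizes a S → f S ∈ cartesianProduct αs κs × Typed (f S)
    to S indep =
      ∈-cartesianProduct⁺
        -- A set of colours among `k` has at most `k` elements, so the type is among those listed in
        -- `Y`.
        (∈-vecs _ λ v → ∈-upTo⁺ (s≤s (subst (_≤ k)
          (sym (Vec.lookup-map v ∣_∣ (Vec.transpose S))) (∣p∣≤n (lookup (Vec.transpose S) v)))))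
        (∈-vecs _ λ v → ∈-subsets _) ,
      Equivalence.from (proper⇔independent S) (proj₁ ∘ indep) ,
      (λ v → sym (Vec.lookup-map v ∣_∣ (Vec.transpose S))) ,
      (λ c → trans (colourClass-size S c) (proj₂ (indep c)))

    from : ∀ {ακ} → Typed ακ → ∃ λ S → S ∈ vecs (subsets order) k × IndependentOfSizes a S × ακ ≡ f S
    from {α , κ} typed = S , ∈-vecs S (λ c → ∈-subsets _) ,
      (λ c → Equivalence.to (proper⇔independent S) proper c , trans (sym (colourClass-size S c)) (mono c)) ,
      cong₂ _,_ (lookup-ext _ _ λ v → trans (sym (type v)) (sym (Vec.lookup-map v ∣_∣ (Vec.transpose S))))
                (sym (transpose-involutive κ))
      where
      S = Vec.transpose κ
      -- Rewriting `κ` as the transpose of `S` makes the facts about colour classes applicable.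
      typed′ = subst (λ κ → Typed (α , κ)) (sym (transpose-involutive κ)) typed
      proper = proj₁ typed′
      type   = proj₁ (proj₂ typed′)
      mono   = proj₂ (proj₂ typed′)

-- Partitions

-- The two proof fields are propositions, so only the list of parts matters.
parts-injective : ∀ {μ ν} → parts μ ≡ parts ν → μ ≡ ν
parts-injective {partition l d p} {partition .l d′ p′} refl =
  cong₂ (partition l) (Linked.irrelevant ℕ.≤-irrelevant d d′) (All.irrelevant ℕ.≤-irrelevant p p′)

IsPartition : List ℕ → Set
IsPartition l = Linked _≥_ l × All (0 <_) l

isPartition? : Decidable IsPartition
isPartition? l = Linked.linked? _≥?_ l ×-dec All.all? (0 <?_) l

-- Reduces membership and uniqueness in `partitions` to an ordinary filter on lists of numbers.
parts-mapMaybe : ∀ ls → map parts (mapMaybe toPartition ls) ≡ filter isPartition? ls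
parts-mapMaybe []       = refl
parts-mapMaybe (l ∷ ls) with isPartition? l
... | yes p = trans (cong (l ∷_) (parts-mapMaybe ls)) (sym (filter-accept isPartition? p))
... | no ¬p = trans (parts-mapMaybe ls) (sym (filter-reject isPartition? ¬p))

toList-injective : ∀ {n} {v w : Vec A n} → Vec.toList v ≡ Vec.toList w → v ≡ w
toList-injective {v = v} {w} eq =
  trans (sym (Vec.cast-is-id refl v)) (Vec.toList-injective refl v w eq)

lists : List A → ℕ → List (List A)
lists xs l = map Vec.toList (vecs xs l)

lists-! : {xs : List A} → Unique xs → ∀ l → Unique (lists xs l)
lists-! xs! l = Unique.map⁺ toList-injective (vecs-! xs! l)

∈-lists : {xs : List A} (l : List A) → All (_∈ xs) l → l ∈ lists xs (length l)
∈-lists l ∈xs = subst (_∈ lists _ (length l)) (Vec.toList∘fromList l)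
  (∈-map⁺ Vec.toList (∈-vecs (Vec.fromList l) (VecAll.lookup⁺ (VecAll.fromList⁺ ∈xs))))

∈-lists⇒length : ∀ (xs : List A) {n l} → l ∈ lists xs n → length l ≡ n
∈-lists⇒length xs l∈ with v , _ , refl ← ∈-map⁻ Vec.toList l∈ = Vec.length-toList v

entries≤sum : ∀ l → All (_≤ sum l) l
entries≤sum []      = []
entries≤sum (x ∷ l) = ℕ.m≤m+n x (sum l) ∷ All.map (λ y≤ → ℕ.≤-trans y≤ (ℕ.m≤n+m (sum l) x)) (entries≤sum l)

length≤sum : ∀ {l} → All (0 <_) l → length l ≤ sum l
length≤sum []        = z≤n
length≤sum (0<x ∷ p) = ℕ.+-mono-≤ 0<x (length≤sum p)

module _ (d : ℕ) where

  private
    candidates ofSum : List (List ℕ)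
    candidates = concatMap (lists (upTo (suc d))) (upTo (suc d))
    ofSum      = filter (λ l → sum l ≟ d) candidates

    parts-partitions : map parts (partitions d) ≡ filter isPartition? ofSum
    parts-partitions = parts-mapMaybe ofSum

    -- The blocks consist of lists of different lengths, hence are disjoint.
    candidates-! : Unique candidates
    candidates-! = Unique.concat⁺
      (All.map⁺ (All.universal (lists-! (Unique.upTo⁺ (suc d))) (upTo (suc d))))
      (AllPairs.map⁺ (AllPairs.map
        (λ l≢l′ {_} (∈l , ∈l′) → l≢l′ (trans
          (sym (∈-lists⇒length (upTo (suc d)) ∈l)) (∈-lists⇒length (upTo (suc d)) ∈l′)))
        (Unique.upTo⁺ (suc d))))

    -- Positive parts bound the length by the sum, and each entry is at most the sum, so the search
    -- range up to `d` suffices.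
    ∈-candidates : ∀ {l} → All (0 <_) l → sum l ≡ d → l ∈ candidates
    ∈-candidates {l} l>0 refl = ∈-concat⁺′
      (∈-lists l (All.map (∈-upTo⁺ ∘ s≤s) (entries≤sum l)))
      (∈-map⁺ (lists (upTo (suc d))) (∈-upTo⁺ (s≤s (length≤sum l>0))))

  ∈-partitions : ∀ {μ} → sum (parts μ) ≡ d → μ ∈ partitions d
  ∈-partitions {μ} eq =
    let ν , ν∈ , μ≡ν = ∈-map⁻ parts (subst (parts μ ∈_) (sym parts-partitions)
          (∈-filter⁺ isPartition? (∈-filter⁺ (λ l → sum l ≟ d) (∈-candidates (positive μ) eq) eq)
            (decreasing μ , positive μ)))
    in subst (_∈ partitions d) (sym (parts-injective μ≡ν)) ν∈

  ∈-partitions⇒sum : ∀ {μ} → μ ∈ partitions d → sum (parts μ) ≡ d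
  ∈-partitions⇒sum {μ} μ∈ = proj₂ (∈-filter⁻ (λ l → sum l ≟ d) {xs = candidates}
    (proj₁ (∈-filter⁻ isPartition? {xs = ofSum} (subst (parts μ ∈_) parts-partitions (∈-map⁺ parts μ∈)))))

  partitions-! : Unique (partitions d)
  partitions-! = Unique.map⁻ (subst Unique (sym parts-partitions)
    (Unique.filter⁺ isPartition? (Unique.filter⁺ (λ l → sum l ≟ d) candidates-!)))

-- Tableaux

fillings-! : ∀ k ls → Unique (fillings k ls)
fillings-! k []       = [] ∷ []
fillings-! k (l ∷ ls) =
  Unique.cartesianProductWith⁺ _∷_ List.∷-injective (lists-! (Unique.allFin⁺ k) l) (fillings-! k ls)

∈-fillings : (T : Tableau k) → T ∈ fillings k (map length T)
∈-fillings []      = here refl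
∈-fillings (r ∷ T) = ∈-cartesianProductWith⁺ _∷_
  (∈-lists r (All.universal ∈-allFin r)) (∈-fillings T)

∈-fillings⇒shape : ∀ ls {T : Tableau k} → T ∈ fillings k ls → map length T ≡ ls
∈-fillings⇒shape []       (here refl) = refl
∈-fillings⇒shape (l ∷ ls) T∈
  with r , T , r∈ , T∈ , refl ← ∈-cartesianProductWith⁻ _∷_ (lists (allFin _) l) (fillings _ ls) T∈
  = cong₂ _∷_ (∈-lists⇒length (allFin _) r∈) (∈-fillings⇒shape ls T∈)

-- The Kostka number of shape `ls` and content `a`; `s μ a` unfolds to `+ kostka (parts μ) a`.
kostka : List ℕ → Vec ℕ k → ℕ
kostka ls a = count (λ T → semistandard? T ×-dec hasContent? a T) (fillings _ ls)

-- Kostka numbers in two variables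

pattern 𝟎 = Fin.zero
pattern 𝟏 = Fin.suc Fin.zero

-- The normal form of a weakly increasing row in two letters.
word : ℕ → ℕ → List (Fin 2)
word a b = replicate a 𝟎 ++ replicate b 𝟏

sorted⇒word : {r : List (Fin 2)} → Linked Fin._≤_ r → ∃₂ λ a b → r ≡ word a b
sorted⇒word []              = 0 , 0 , refl
sorted⇒word ([-] {𝟎})       = 1 , 0 , refl
sorted⇒word ([-] {𝟏})       = 0 , 1 , refl
sorted⇒word (_∷_ {𝟎} _ inc) with a , b , eq ← sorted⇒word inc = suc a , b , cong (𝟎 ∷_) eq
sorted⇒word (_∷_ {𝟏} 1≤y inc) with sorted⇒word inc
sorted⇒word (_∷_ {𝟏} ()  inc) | suc a , b , refl
sorted⇒word (_∷_ {𝟏} 1≤y inc) | zero  , b , eq = 0 , suc b , cong (𝟏 ∷_) eq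

word-sorted : ∀ a b → Linked Fin._≤_ (word a b)
word-sorted zero          zero          = []
word-sorted zero          (suc zero)    = [-]
word-sorted zero          (suc (suc b)) = s≤s z≤n ∷ word-sorted zero (suc b)
word-sorted (suc zero)    zero          = [-]
word-sorted (suc zero)    (suc b)       = z≤n ∷ word-sorted zero (suc b)
word-sorted (suc (suc a)) b             = z≤n ∷ word-sorted (suc a) b

length-word : ∀ a b → length (word a b) ≡ a + b
length-word a b = trans (length-++ (replicate a 𝟎)) (cong₂ _+_ (length-replicate a) (length-replicate b))

count-word : ∀ i a b → count (i Fin.≟_) (word a b) ≡ lookup (a ∷ b ∷ []) i
count-word 𝟎 zero    zero    = refl
count-word 𝟎 zero    (suc b) = count-word 𝟎 zero b
count-word 𝟎 (suc a) b       = cong suc (count-word 𝟎 a b)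
count-word 𝟏 zero    zero    = refl
count-word 𝟏 zero    (suc b) = cong suc (count-word 𝟏 zero b)
count-word 𝟏 (suc a) b       = count-word 𝟏 a b

-- An entry strictly below another cannot be the smallest letter. The length bound ensures that
-- `zip` truncates no cell of `r′`.
above⇒ones : (r r′ : List (Fin 2)) → length r′ ≤ length r → r Above r′ → r′ ≡ word 0 (length r′)
above⇒ones r       []       _         _         = refl
above⇒ones (_ ∷ r) (𝟏 ∷ r′) (s≤s len) (_ ∷ r>r′) = cong (𝟏 ∷_) (above⇒ones r r′ len r>r′)

word-above : ∀ {a b q} → q ≤ a → word a b Above word 0 q
word-above {zero} {zero}  z≤n       = []
word-above {zero} {suc b} z≤n       = []
word-above {suc a}        z≤n       = []
word-above {suc a} {b}    (s≤s q≤a) = s≤s z≤n ∷ word-above {a} {b} q≤a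

content₁ : ∀ i a b → count (i Fin.≟_) (concat (word a b ∷ [])) ≡ lookup (a ∷ b ∷ []) i
content₁ i a b = trans (cong (count (i Fin.≟_)) (++-identityʳ (word a b))) (count-word i a b)

content₂ : ∀ i a b q → count (i Fin.≟_) (concat (word a b ∷ word 0 q ∷ [])) ≡ lookup (a ∷ b + q ∷ []) i
content₂ i a b q = trans (count-++ (i Fin.≟_) (word a b) _)
  (trans (cong₂ _+_ (count-word i a b) (content₁ i 0 q)) (add i))
  where
  add : ∀ i → lookup (a ∷ b ∷ []) i + lookup (0 ∷ q ∷ []) i ≡ lookup (a ∷ b + q ∷ []) i
  add 𝟎 = ℕ.+-identityʳ a
  add 𝟏 = refl

-- A sorted row is determined by its content.
kostka-one-row : ∀ m n → kostka (m + n ∷ []) (m ∷ n ∷ []) ≡ 1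
kostka-one-row m n = count-unique (fillings-! 2 (m + n ∷ []))
  (subst (λ l → (word m n ∷ []) ∈ fillings 2 (l ∷ [])) (length-word m n) (∈-fillings (word m n ∷ [])))
  ((word-sorted m n ∷ [] , [-]) , λ i → content₁ i m n)
  only
  where
  only : ∀ {T} → T ∈ fillings 2 (m + n ∷ []) → Semistandard T × HasContent (m ∷ n ∷ []) T → T ≡ word m n ∷ []
  only {T} T∈ _ with ∈-fillings⇒shape (m + n ∷ []) T∈
  only {r ∷ []} T∈ ((inc ∷ [] , _) , content) | _ with a , b , refl ← sorted⇒word inc =
    cong [_] (cong₂ word (trans (sym (content₁ 𝟎 a b)) (content 𝟎)) (trans (sym (content₁ 𝟏 a b)) (content 𝟏)))

-- The second row consists of `𝟏` only, so every `𝟎` lies in the first row; `b` is the number of `𝟏`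
-- there.
two-row-tableau : ∀ {p q m n T} → q ≤ p → T ∈ fillings 2 (p ∷ q ∷ []) →
                  Semistandard T → HasContent (m ∷ n ∷ []) T →
                  ∃ λ b → T ≡ word m b ∷ word 0 q ∷ [] × b + q ≡ n
two-row-tableau {p} {q} {T = T} _ T∈ _ _ with ∈-fillings⇒shape (p ∷ q ∷ []) T∈
two-row-tableau {m = m} {n} {T = r ∷ r′ ∷ []} q≤p _ (inc ∷ _ ∷ [] , above ∷ [-]) content | refl
  with a , b , refl ← sorted⇒word inc =
  b , cong₂ (λ a r′ → word a b ∷ r′ ∷ []) (content′ 𝟎) r′-ones , content′ 𝟏
  where
  l = length r′
  r′-ones = above⇒ones r r′ q≤p above
  content′ : ∀ i → lookup (a ∷ b + l ∷ []) i ≡ lookup (m ∷ n ∷ []) i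
  content′ i = trans (sym (content₂ i a b l))
    (trans (cong (λ r′ → count (i Fin.≟_) (concat (word a b ∷ r′ ∷ []))) (sym r′-ones)) (content i))

module _ {p q} (m n : ℕ) (q≤p : q ≤ p) where

  private
    shape : List ℕ
    shape = p ∷ q ∷ []

  -- The second row alone would need `q` copies of `𝟏`.
  kostka-two-rows-< : n < q → kostka shape (m ∷ n ∷ []) ≡ 0
  kostka-two-rows-< n<q = count-none {xs = fillings 2 shape} λ T∈ (T! , content) →
    let b , _ , b+q≡n = two-row-tableau q≤p T∈ T! content
    in ℕ.<⇒≱ n<q (subst (q ≤_) b+q≡n (ℕ.m≤n+m q b))

  -- The only candidate puts the remaining `n ∸ q` copies of `𝟏` at the end of the first row. Its
  -- columns increase because `q ≤ n ≤ m` places the whole second row under copies of `𝟎`.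
  kostka-two-rows-≥ : p + q ≡ m + n → n ≤ m → q ≤ n → kostka shape (m ∷ n ∷ []) ≡ 1
  kostka-two-rows-≥ p+q≡m+n n≤m q≤n = count-unique (fillings-! 2 shape)
    (subst (λ ls → T ∈ fillings 2 ls) T-shape (∈-fillings T))
    ((word-sorted m e ∷ word-sorted 0 q ∷ [] , word-above {m} {e} (ℕ.≤-trans q≤n n≤m) ∷ [-]) ,
     λ i → trans (content₂ i m e q) (cong (λ n → lookup (m ∷ n ∷ []) i) e+q≡n))
    λ T∈ (T! , content) →
      let b , T≡ , b+q≡n = two-row-tableau q≤p T∈ T! content
      in trans T≡ (cong (λ b → word m b ∷ word 0 q ∷ []) (ℕ.+-cancelʳ-≡ q b e (trans b+q≡n (sym e+q≡n))))
    where
    open ≡-Reasoning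
    e : ℕ
    e = n ∸ q
    T : Tableau 2
    T = word m e ∷ word 0 q ∷ []
    e+q≡n : e + q ≡ n
    e+q≡n = ℕ.m∸n+n≡m q≤n
    m+e≡p : m + e ≡ p
    m+e≡p = ℕ.+-cancelʳ-≡ q (m + e) p (begin
      m + e + q    ≡⟨ ℕ.+-assoc m e q ⟩
      m + (e + q)  ≡⟨ cong (λ z → m + z) e+q≡n ⟩
      m + n        ≡⟨ p+q≡m+n ⟨
      p + q        ∎)
    T-shape : map length T ≡ shape
    T-shape = cong₂ (λ p q → p ∷ q ∷ []) (trans (length-word m e) m+e≡p) (length-word 0 q)

-- The first column would be strictly increasing with three entries from two letters.
no-three-rows : ∀ {r₁ r₂ r₃ : List (Fin 2)} → 0 < length r₁ → 0 < length r₂ → 0 < length r₃ →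
                r₁ Above r₂ → ¬ r₂ Above r₃
no-three-rows {x ∷ _} {y ∷ _} {z ∷ _} _ _ _ (x<y ∷ _) (y<z ∷ _) =
  ℕ.<⇒≱ (Fin.toℕ<n z) (ℕ.≤-trans (s≤s (ℕ.≤-trans (s≤s z≤n) x<y)) y<z)

kostka-three-rows : ∀ {p q r} ls (a : Vec ℕ 2) → 0 < p → 0 < q → 0 < r → kostka (p ∷ q ∷ r ∷ ls) a ≡ 0
kostka-three-rows {p} {q} {r} ls a 0<p 0<q 0<r =
  count-none {xs = fillings 2 (p ∷ q ∷ r ∷ ls)} λ T∈ (T! , _) →
    none 0<p 0<q 0<r (∈-fillings⇒shape (p ∷ q ∷ r ∷ ls) T∈) T!
  where
  none : ∀ {p q r ls} {T : Tableau 2} → 0 < p → 0 < q → 0 < r →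
         map length T ≡ p ∷ q ∷ r ∷ ls → ¬ Semistandard T
  none {T = _ ∷ _ ∷ _ ∷ _} 0<p 0<q 0<r refl (_ , r₁>r₂ ∷ r₂>r₃ ∷ _) = no-three-rows 0<p 0<q 0<r r₁>r₂ r₂>r₃

-- Extracting coefficients

sumℤ-zero : (h : A → ℤ) (xs : List A) → (∀ {y} → y ∈ xs → h y ≡ 0ℤ) → sumℤ (map h xs) ≡ 0ℤ
sumℤ-zero h []       h≡0 = refl
sumℤ-zero h (x ∷ xs) h≡0 = cong₂ ℤ._+_ (h≡0 (here refl)) (sumℤ-zero h xs (h≡0 ∘ there))

sumℤ-single : (h : A → ℤ) {xs : List A} {x : A} → Unique xs → x ∈ xs →
              (∀ {y} → y ∈ xs → y ≢ x → h y ≡ 0ℤ) → sumℤ (map h xs) ≡ h x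
sumℤ-single h {x ∷ xs} (x∉xs ∷ xs!) (here refl) h≡0 = trans
  (cong (λ z → h x ℤ.+ z) (sumℤ-zero h xs λ y∈ → h≡0 (there y∈) (λ y≡x → All.lookup x∉xs y∈ (sym y≡x))))
  (ℤ.+-identityʳ (h x))
sumℤ-single h {z ∷ xs} {x} (z∉xs ∷ xs!) (there x∈xs) h≡0 = begin
  h z ℤ.+ sumℤ (map h xs)  ≡⟨ cong₂ ℤ._+_ (h≡0 (here refl) (All.lookup z∉xs x∈xs))
                                (sumℤ-single h xs! x∈xs (h≡0 ∘ there)) ⟩
  0ℤ ℤ.+ h x               ≡⟨ ℤ.+-identityˡ (h x) ⟩
  h x                      ∎
  where open ≡-Reasoning

sumℤ-minus : (f g : A → ℤ) (xs : List A) →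
         sumℤ (map (λ x → f x ℤ.- g x) xs) ≡ sumℤ (map f xs) ℤ.- sumℤ (map g xs)
sumℤ-minus f g []       = refl
sumℤ-minus f g (x ∷ xs) rewrite sumℤ-minus f g xs = interchange (f x) (g x) (sumℤ (map f xs)) (sumℤ (map g xs))
  where
  interchange : ∀ a b c d → (a ℤ.- b) ℤ.+ (c ℤ.- d) ≡ (a ℤ.+ c) ℤ.- (b ℤ.+ d)
  interchange = ℤ-Solver.solve-∀

module _ {f : Series} (expansion : SchurExpansion f) where
  open SchurExpansion expansion

  -- With exponent 0 at x₂ no second row can be filled, so `μ` is the only partition of `m` that
  -- contributes. The empty partition is the case `m = 0`.
  coefficient-one-row : ∀ μ m → ℓ⟨ μ ⟩ ≤ 1 → sum (parts μ) ≡ m → [s μ ] ≡ f (m ∷ 0 ∷ [])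
  coefficient-one-row μ m ℓ≤1 refl = sym (begin
    f a                                                 ≡⟨ expands a ⟩
    sumℤ (map (λ ν → [s ν ] ℤ.* s ν a) (partitions (m + 0)))
      ≡⟨ cong (λ d → sumℤ (map (λ ν → [s ν ] ℤ.* s ν a) (partitions d))) (ℕ.+-identityʳ m) ⟩
    sumℤ (map (λ ν → [s ν ] ℤ.* s ν a) (partitions m))
      ≡⟨ sumℤ-single (λ ν → [s ν ] ℤ.* s ν a) (partitions-! m) (∈-partitions _ refl)
           (λ {ν} ν∈ ν≢μ → trans
             (cong (λ z → [s ν ] ℤ.* + z) (zero-other ν (∈-partitions⇒sum m ν∈) ν≢μ))
             (ℤ.*-zeroʳ [s ν ])) ⟩
    [s μ ] ℤ.* s μ a                                    ≡⟨ cong (λ z → [s μ ] ℤ.* + z) (one μ ℓ≤1) ⟩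
    [s μ ] ℤ.* 1ℤ                                     ≡⟨ ℤ.*-identityʳ [s μ ] ⟩
    [s μ ]                                              ∎)
    where
    open ≡-Reasoning
    a = m ∷ 0 ∷ []

    one : ∀ ν → ℓ⟨ ν ⟩ ≤ 1 → kostka (parts ν) (sum (parts ν) ∷ 0 ∷ []) ≡ 1
    one (partition []          _ _) _ = refl
    one (partition (p ∷ [])    _ _) _
      rewrite ℕ.+-identityʳ p =
      subst (λ l → kostka (l ∷ []) (p ∷ 0 ∷ []) ≡ 1) (ℕ.+-identityʳ p) (kostka-one-row p 0)
    one (partition (_ ∷ _ ∷ _) _ _) (s≤s ())

    one-row-unique : ∀ μ ν → ℓ⟨ μ ⟩ ≤ 1 → ℓ⟨ ν ⟩ ≤ 1 → sum (parts ν) ≡ sum (parts μ) → ν ≡ μ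
    one-row-unique (partition []          _ _) (partition [] _ _) _ _ _ = parts-injective refl
    -- Splitting the first part exposes the contradiction: a successor makes the sum nonzero, and a
    -- zero part violates positivity.
    one-row-unique (partition []          _ _) (partition (suc _ ∷ _) _ _) _ _ ()
    one-row-unique (partition []          _ _) (partition (zero ∷ _) _ (() ∷ _)) _ _ _
    one-row-unique (partition (suc _ ∷ _)    _ _) (partition [] _ _) _ _ ()
    one-row-unique (partition (zero ∷ _)    _ (() ∷ _)) (partition [] _ _) _ _ _
    one-row-unique (partition (p ∷ [])    _ _) (partition (q ∷ []) _ _) _ _ eq =
      parts-injective (cong [_] (ℕ.+-cancelʳ-≡ 0 q p eq))
    one-row-unique (partition (_ ∷ _ ∷ _) _ _) _ (s≤s ())
    one-row-unique _ (partition (_ ∷ _ ∷ _) _ _) _ (s≤s ())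

    zero-other : ∀ ν → sum (parts ν) ≡ m → ν ≢ μ → kostka (parts ν) a ≡ 0
    zero-other ν@(partition []       _ _) eq ν≢μ = contradiction (one-row-unique μ ν ℓ≤1 z≤n eq) ν≢μ
    zero-other ν@(partition (_ ∷ []) _ _) eq ν≢μ = contradiction (one-row-unique μ ν ℓ≤1 (s≤s z≤n) eq) ν≢μ
    zero-other (partition (p ∷ q ∷ [])    (q≤p ∷ _) (_ ∷ 0<q ∷ _)) _ _ = kostka-two-rows-< m 0 q≤p 0<q
    zero-other (partition (_ ∷ _ ∷ _ ∷ ls) _ (0<p ∷ 0<q ∷ 0<r ∷ _)) _ _ = kostka-three-rows ls a 0<p 0<q 0<r

  -- The two monomials have equal Kostka numbers for every partition of their degree except `μ`,
  -- where the numbers are 1 and 0.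
  coefficient-two-rows : ∀ μ m n → parts μ ≡ m ∷ suc n ∷ [] →
    [s μ ] ≡ f (m ∷ suc n ∷ []) ℤ.- f (suc m ∷ n ∷ [])
  coefficient-two-rows μ m n refl = sym (begin
    f a ℤ.- f b
      ≡⟨ cong₂ ℤ._-_ (expands a) (expands b) ⟩
    sumℤ (map (term a) (partitions d)) ℤ.- sumℤ (map (term b) (partitions (Vec.sum b)))
      -- Both monomials have the same degree, so the two sums run over one list and can be
      -- subtracted termwise.
      ≡⟨ cong (λ d′ → sumℤ (map (term a) (partitions d)) ℤ.- sumℤ (map (term b) (partitions d′)))
           (ℕ.+-suc m (n + 0)) ⟨
    sumℤ (map (term a) (partitions d)) ℤ.- sumℤ (map (term b) (partitions d))
      ≡⟨ sumℤ-minus (term a) (term b) (partitions d) ⟨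
    sumℤ (map (λ ν → term a ν ℤ.- term b ν) (partitions d))
      ≡⟨ sumℤ-single (λ ν → term a ν ℤ.- term b ν) (partitions-! d) (∈-partitions _ refl)
           (λ {ν} ν∈ ν≢μ → trans
             (cong (λ z → [s ν ] ℤ.* + z ℤ.- term b ν) (same ν (∈-partitions⇒sum d ν∈) ν≢μ))
             (ℤ.+-inverseʳ (term b ν))) ⟩
    term a μ ℤ.- term b μ
      ≡⟨ cong₂ (λ x y → [s μ ] ℤ.* + x ℤ.- [s μ ] ℤ.* + y)
           (kostka-two-rows-≥ m (suc n) n<m refl n<m ℕ.≤-refl) (kostka-two-rows-< (suc m) n n<m ℕ.≤-refl) ⟩
    [s μ ] ℤ.* 1ℤ ℤ.- [s μ ] ℤ.* 0ℤ
      ≡⟨ cong₂ ℤ._-_ (ℤ.*-identityʳ [s μ ]) (ℤ.*-zeroʳ [s μ ]) ⟩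
    [s μ ] ℤ.- 0ℤ
      ≡⟨ ℤ.+-identityʳ [s μ ] ⟩
    [s μ ] ∎)
    where
    open ≡-Reasoning
    a b : Vec ℕ 2
    a = m ∷ suc n ∷ []
    b = suc m ∷ n ∷ []
    d = Vec.sum a
    term : Vec ℕ 2 → Partition → ℤ
    term a ν = [s ν ] ℤ.* s ν a
    n<m : n < m
    n<m = Linked.head (decreasing μ)

    same : ∀ ν → sum (parts ν) ≡ d → ν ≢ μ → kostka (parts ν) a ≡ kostka (parts ν) b
    same (partition [] _ _) eq _ = contradiction (trans eq (ℕ.+-suc m (n + 0))) λ ()
    same (partition (p ∷ []) _ _) eq _ = trans
      (subst (λ l → kostka (l ∷ []) a ≡ 1) (sym p≡) (kostka-one-row m (suc n)))
      (sym (subst (λ l → kostka (l ∷ []) b ≡ 1) (sym (trans p≡ (ℕ.+-suc m n))) (kostka-one-row (suc m) n)))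
      where
      p≡ : p ≡ m + suc n
      p≡ = trans (sym (ℕ.+-identityʳ p)) (trans eq (cong (λ z → m + z) (ℕ.+-identityʳ (suc n))))
    -- For `q ≤ n` both numbers are 1 and for `q > suc n` both are 0. If `q = suc n`, the degree
    -- forces `p = m`, which is the excluded `μ`.
    same (partition (p ∷ q ∷ []) (q≤p ∷ _) _) eq ν≢μ with ℕ.<-cmp q (suc n)
    ... | tri< (s≤s q≤n) _ _ = trans
      (kostka-two-rows-≥ m (suc n) q≤p p+q≡ n<m (ℕ.m≤n⇒m≤1+n q≤n))
      (sym (kostka-two-rows-≥ (suc m) n q≤p (trans p+q≡ (ℕ.+-suc m n))
        (ℕ.≤-trans (ℕ.n≤1+n n) (ℕ.m≤n⇒m≤1+n n<m)) q≤n))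
      where
      p+q≡ : p + q ≡ m + suc n
      p+q≡ = trans (cong (λ z → p + z) (sym (ℕ.+-identityʳ q)))
        (trans eq (cong (λ z → m + z) (ℕ.+-identityʳ (suc n))))
    ... | tri≈ _ refl _ = contradiction
      (parts-injective (cong (_∷ suc n ∷ []) (ℕ.+-cancelʳ-≡ (suc n + 0) p m eq))) ν≢μ
    ... | tri> _ _ n<q = trans (kostka-two-rows-< m (suc n) q≤p n<q)
      (sym (kostka-two-rows-< (suc m) n q≤p (ℕ.≤-trans (ℕ.n≤1+n _) n<q)))
    same (partition (_ ∷ _ ∷ _ ∷ ls) _ (0<p ∷ 0<q ∷ 0<r ∷ _)) _ _ =
      trans (kostka-three-rows ls a 0<p 0<q 0<r) (sym (kostka-three-rows ls b 0<p 0<q 0<r))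

-- Independent sets

-- Keeps the first `j` elements of `S` and drops the rest.
smaller-subset : (S : Subset k) → ∀ {j} → j ≤ ∣ S ∣ → ∃ λ T → T ⊆ S × ∣ T ∣ ≡ j
smaller-subset []            z≤n = [] , id , refl
smaller-subset (outside ∷ S) j≤ with T , T⊆S , eq ← smaller-subset S j≤ =
  outside ∷ T , out⊆ T⊆S , eq
smaller-subset {suc k} (inside ∷ S) z≤n = Subset.⊥ , (λ x∈ → contradiction x∈ ∉⊥) , ∣⊥∣≡0 (suc k)
smaller-subset (inside ∷ S)  (s≤s j≤) with T , T⊆S , eq ← smaller-subset S j≤ =
  inside ∷ T , s⊆s T⊆S , cong suc eq

module _ (G : Graph) where
  open Graph G using (order; _~_)

  private
    i = independentSets G
    d = independenceNumber G

  independent-size≤ : ∀ {S} → Independent G S → ∣ S ∣ ≤ d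
  independent-size≤ {S} indep = All.lookup (xs≤max 0 (map ∣_∣ (filter (independent? G) (subsets order))))
    (∈-map⁺ ∣_∣ (∈-filter⁺ (independent? G) (∈-subsets S) indep))

  maximum-independent : ∃ λ S → Independent G S × ∣ S ∣ ≡ d
  maximum-independent with argmax-sel id 0 (map ∣_∣ (filter (independent? G) (subsets order)))
  -- The default value 0 of `max` is attained by the empty set.
  ... | inj₁ d≡0 = Subset.⊥ , (λ _ _ u∈ → contradiction u∈ ∉⊥) , trans (∣⊥∣≡0 order) (sym d≡0)
  ... | inj₂ d∈ with S , S∈ , d≡ ← ∈-map⁻ ∣_∣ d∈ =
    S , proj₂ (∈-filter⁻ (independent? G) {xs = subsets order} S∈) , sym d≡

  independentSets-beyond : ∀ {j} → d < j → i j ≡ 0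
  independentSets-beyond d<j =
    count-none {xs = subsets order} λ where _ (indep , refl) → ℕ.<⇒≱ d<j (independent-size≤ indep)

  -- A maximum independent set contains a subset of every smaller size, and that subset is again
  -- independent.
  independentSets-positive : ∀ {j} → j ≤ d → 0 < i j
  independentSets-positive {j} j≤d =
    let S , indep , ∣S∣≡d = maximum-independent
        T , T⊆S , ∣T∣≡j   = smaller-subset S (subst (j ≤_) (sym ∣S∣≡d) j≤d)
    in filter-some (λ S → independent? G S ×-dec (∣ S ∣ ≟ j)) (Any.map
         (λ { refl → (λ u v u∈ v∈ → indep u v (T⊆S u∈) (T⊆S v∈)) , ∣T∣≡j }) (∈-subsets T))

-- Log-concave sequences

module _ (b : ℕ → ℕ) where

  module _ (logConcave : ∀ n → b n * b (2 + n) ≤ b (1 + n) * b (1 + n))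
           (noInternalZeros : ∀ {m n} → m ≤ n → 0 < b n → 0 < b m) where

    -- The ratios of consecutive terms decrease weakly. Free of division: multiply the inequality
    -- for gap `g` by log-concavity at the right end and cancel the common factor `u * v`.
    logConcave⇒balanced : ∀ n g → b n * b (2 + (g + n)) ≤ b (1 + n) * b (1 + (g + n))
    logConcave⇒balanced n zero    = logConcave n
    logConcave⇒balanced n (suc g) with b (3 + (g + n)) in eq
    -- If the last term vanishes, so does the left side; otherwise the absence of internal zeros
    -- makes `u` and `v` positive.
    ... | zero  = subst (_≤ b (1 + n) * b (2 + (g + n))) (sym (ℕ.*-zeroʳ (b n))) z≤n
    ... | suc w′ = ℕ.*-cancelʳ-≤ (x * w) (y * v) (u * v) {{ℕ.m*n≢0 u v}} (begin
        x * w * (u * v)    ≡⟨ lhs x w u v ⟩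
        x * v * (u * w)    ≤⟨ ℕ.*-mono-≤ (logConcave⇒balanced n g) uw≤vv ⟩
        y * u * (v * v)    ≡⟨ rhs y u v ⟩
        y * v * (u * v)    ∎)
      where
      open ℕ.≤-Reasoning
      x = b n
      y = b (1 + n)
      u = b (1 + (g + n))
      v = b (2 + (g + n))
      w = suc w′
      0<w : 0 < b (3 + (g + n))
      0<w = subst (0 <_) (sym eq) (s≤s z≤n)
      instance
        u≢0 : NonZero u
        u≢0 = >-nonZero (noInternalZeros (s≤s (ℕ.≤-trans (ℕ.n≤1+n _) (ℕ.n≤1+n _))) 0<w)
        v≢0 : NonZero v
        v≢0 = >-nonZero (noInternalZeros (s≤s (s≤s (ℕ.n≤1+n _))) 0<w)
      uw≤vv : u * w ≤ v * v
      uw≤vv = subst (λ w → u * w ≤ v * v) eq (logConcave (1 + (g + n)))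
      lhs : ∀ x w u v → x * w * (u * v) ≡ x * v * (u * w)
      lhs = ℕ-Solver.solve-∀
      rhs : ∀ y u v → y * u * (v * v) ≡ y * v * (u * v)
      rhs = ℕ-Solver.solve-∀

    logConcave⇒adjacent : ∀ {m n} → m < n → b m * b (suc n) ≤ b (suc m) * b n
    logConcave⇒adjacent {m} {n} m<n = subst (λ n → b m * b (suc n) ≤ b (suc m) * b n) n≡
      (logConcave⇒balanced m (n ∸ suc m))
      where
      n≡ : 1 + ((n ∸ suc m) + m) ≡ n
      n≡ = trans (sym (ℕ.+-suc (n ∸ suc m) m)) (ℕ.m∸n+n≡m m<n)

    -- The outer indices `p` and `g + n` move towards each other in `g` unit steps, each an instance
    -- of `logConcave⇒adjacent`.
    logConcave⇒strong : ∀ g {p n} → g + p ≤ n → b p * b (g + n) ≤ b (g + p) * b n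
    logConcave⇒strong zero            _     = ℕ.≤-refl
    logConcave⇒strong (suc g) {p} {n} g+p<n = begin
      b p * b (suc (g + n))    ≡⟨ cong (λ k → b p * b k) (ℕ.+-suc g n) ⟨
      b p * b (g + suc n)      ≤⟨ logConcave⇒strong g (ℕ.m≤n⇒m≤1+n (ℕ.<⇒≤ g+p<n)) ⟩
      b (g + p) * b (suc n)    ≤⟨ logConcave⇒adjacent g+p<n ⟩
      b (suc g + p) * b n      ∎
      where open ℕ.≤-Reasoning

-- Log-concavity of the independence polynomial

module _ (G : Graph) where

  private
    i = independentSets G
    d = independenceNumber G

  -- Removes the degree bound: when `1 + n` is at least the degree, `i (2 + n)` is 0.
  logConcave⇔ : LogConcave (independencePolynomial G) ⇔ (∀ n → i n * i (2 + n) ≤ i (1 + n) * i (1 + n))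
  logConcave⇔ = mk⇔ to from
    where
    to : LogConcave (independencePolynomial G) → ∀ n → i n * i (2 + n) ≤ i (1 + n) * i (1 + n)
    to lc n with 1 + n <? d
    ... | yes 1+n<d =
      subst (λ k → i n * i k ≤ i (1 + n) * i (1 + n)) (ℕ.+-comm (1 + n) 1) (lc (1 + n) (s≤s z≤n) 1+n<d)
    ... | no  1+n≮d = begin
      i n * i (2 + n)        ≡⟨ cong (λ k → i n * k) (independentSets-beyond G (s≤s (ℕ.≮⇒≥ 1+n≮d))) ⟩
      i n * 0                ≡⟨ ℕ.*-zeroʳ (i n) ⟩
      0                      ≤⟨ z≤n ⟩
      i (1 + n) * i (1 + n)  ∎
      where open ℕ.≤-Reasoning
    from : (∀ n → i n * i (2 + n) ≤ i (1 + n) * i (1 + n)) → LogConcave (independencePolynomial G)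
    from lc (suc n) _ _ = subst (λ k → i n * i k ≤ i (1 + n) * i (1 + n)) (ℕ.+-comm 1 (1 + n)) (lc n)

  independentSets-noInternalZeros : ∀ {m n} → m ≤ n → 0 < i n → 0 < i m
  independentSets-noInternalZeros {m} {n} m≤n 0<iₙ = independentSets-positive G (ℕ.≤-trans m≤n
    (ℕ.≮⇒≥ λ d<n → ℕ.<⇒≢ 0<iₙ (sym (independentSets-beyond G d<n))))

  logConcave⇔stronglyLogConcave :
    LogConcave (independencePolynomial G) ⇔ StronglyLogConcave (independencePolynomial G)
  logConcave⇔stronglyLogConcave = mk⇔ strong (λ slc → λ where
      -- Log-concavity is the case of equal inner indices with the outer ones at distance 1.
      (suc n) _ 1+n<d → slc n (suc n) (suc n) (suc n + 1) ℕ.≤-refl ℕ.≤-refl (ℕ.m<m+n (suc n) (s≤s z≤n))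
        (subst (_≤ d) (ℕ.+-comm 1 (suc n)) 1+n<d)
        (sum-eq n))
    where
    sum-eq : ∀ n → suc n + suc n ≡ n + (suc n + 1)
    sum-eq = ℕ-Solver.solve-∀
    strong : LogConcave (independencePolynomial G) → StronglyLogConcave (independencePolynomial G)
    strong lc p m n q p<m m≤n n<q q≤d m+n≡p+q =
      subst (λ (m , q) → i p * i q ≤ i m * i n) (cong₂ _,_ g+p≡m g+n≡q)
        (logConcave⇒strong i (Equivalence.to logConcave⇔ lc) independentSets-noInternalZeros
          g (subst (_≤ n) (sym g+p≡m) m≤n))
      where
      open ≡-Reasoning
      g : ℕ
      -- Equal index sums give `q ∸ n = m ∸ p`, so both outer indices move by the same `g`.
      g = m ∸ p
      g+p≡m : g + p ≡ m
      g+p≡m = ℕ.m∸n+n≡m (ℕ.<⇒≤ p<m)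
      g+n≡q : g + n ≡ q
      g+n≡q = ℕ.+-cancelˡ-≡ p (g + n) q (begin
        p + (g + n)  ≡⟨ ℕ.+-assoc p g n ⟨
        p + g + n    ≡⟨ cong (λ k → k + n) (ℕ.+-comm p g) ⟩
        g + p + n    ≡⟨ cong (λ k → k + n) g+p≡m ⟩
        m + n        ≡⟨ m+n≡p+q ⟩
        p + q        ∎)

  -- Schur coefficients of Y_G

  module _ (expansion : SchurExpansion (Y G)) where
    open SchurExpansion expansion

    Y-coefficient₂ : ∀ m n → Y G (m ∷ n ∷ []) ≡ + (i m * i n)
    Y-coefficient₂ m n = trans (Y-coefficient G (m ∷ n ∷ [])) (cong (λ k → + (i m * k)) (ℕ.*-identityʳ (i n)))

    schur-coefficient : ∀ μ m n → parts μ ≡ m ∷ suc n ∷ [] →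
      [s μ ] ≡ + (i m * i (suc n)) ℤ.- + (i (suc m) * i n)
    schur-coefficient μ m n eq = trans (coefficient-two-rows expansion μ m n eq)
      (cong₂ ℤ._-_ (Y-coefficient₂ m (suc n)) (Y-coefficient₂ (suc m) n))

    -- The factors are ordered to match `logConcave⇒adjacent`; for `m = suc n` the inequality is
    -- log-concavity at `suc n`.
    schur-positive⇔ : ∀ μ m n → parts μ ≡ m ∷ suc n ∷ [] →
      0ℤ ≤ℤ [s μ ] ⇔ (i n * i (suc m) ≤ i (suc n) * i m)
    schur-positive⇔ μ m n eq rewrite schur-coefficient μ m n eq
      | ℕ.*-comm (i n) (i (suc m)) | ℕ.*-comm (i (suc n)) (i m) =
      mk⇔ (ℤ.drop‿+≤+ ∘ ℤ.0≤i-j⇒j≤i) (ℤ.i≤j⇒0≤j-i ∘ ℤ.+≤+)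

    -- Such a coefficient is a coefficient of Y_G itself, hence a product of natural numbers.
    one-row-positive : ∀ μ → ℓ⟨ μ ⟩ ≤ 1 → 0ℤ ≤ℤ [s μ ]
    one-row-positive μ ℓ≤1 = subst (0ℤ ≤ℤ_)
      (sym (trans (coefficient-one-row expansion μ _ ℓ≤1 refl) (Y-coefficient₂ (sum (parts μ)) 0)))
      (ℤ.+≤+ z≤n)

    schur-positive : LogConcave (independencePolynomial G) → ∀ μ → ℓ⟨ μ ⟩ ≤ 2 → 0ℤ ≤ℤ [s μ ]
    schur-positive lc μ@(partition (m ∷ suc n ∷ []) (n<m ∷ _) _) _ =
      Equivalence.from (schur-positive⇔ μ m n refl)
        (logConcave⇒adjacent i (Equivalence.to logConcave⇔ lc) independentSets-noInternalZeros n<m)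
    schur-positive lc (partition (_ ∷ zero ∷ []) _ (_ ∷ () ∷ _)) _
    schur-positive lc μ@(partition []       _ _) _ = one-row-positive μ z≤n
    schur-positive lc μ@(partition (_ ∷ []) _ _) _ = one-row-positive μ (s≤s z≤n)
    schur-positive lc (partition (_ ∷ _ ∷ _ ∷ _) _ _) (s≤s (s≤s ()))

    two-equal⇒logConcave : (∀ k (k≥1 : 1 ≤ k) → 0ℤ ≤ℤ [s twoEqualParts k k≥1 ]) →
                           LogConcave (independencePolynomial G)
    two-equal⇒logConcave pos = Equivalence.from logConcave⇔ λ n →
      Equivalence.to (schur-positive⇔ (twoEqualParts (suc n) (s≤s z≤n)) (suc n) n refl)
        (pos (suc n) (s≤s z≤n))

corollary2p2 : (G : Graph) (expansion : SchurExpansion (Y G)) →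
  let open SchurExpansion expansion
      I = independencePolynomial G
      condition1 = ∀ (μ : Partition) → ℓ⟨ μ ⟩ ≤ 2 → 0ℤ ≤ℤ [s μ ]
      condition2 = ∀ k (k≥1 : 1 ≤ k) → 0ℤ ≤ℤ [s twoEqualParts k k≥1 ]
      condition3 = LogConcave I
      condition4 = StronglyLogConcave I
  in (condition1 ⇔ condition2) × (condition2 ⇔ condition3) × (condition3 ⇔ condition4)
corollary2p2 G expansion =
  mk⇔ (λ pos k k≥1 → pos (twoEqualParts k k≥1) ℕ.≤-refl)
      -- The step from rectangular shapes to all shapes with at most two rows passes through
      -- log-concavity.
      (schur-positive G expansion ∘ two-equal⇒logConcave G expansion) ,
  mk⇔ (two-equal⇒logConcave G expansion)
      (λ lc k k≥1 → schur-positive G expansion lc (twoEqualParts k k≥1) ℕ.≤-refl) ,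
  logConcave⇔stronglyLogConcave G
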